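{- The set $\mathcal{F}_{K_4}$ has infinitely many non-isomorphic graphs.
   Context: Graphs are finite, without loops or multiple edges. For a vertex $u$ of a graph $G$, the local complementation $G*u$ is obtained from $G$ by complementing the adjacency between every pair of distinct neighbours of $u$. For an edge $uv$ of $G$, the edge pivot is $G\wedge uv=((G*u)*v)*u$. A graph $G$ contains $H$ as a pivot-minor if $H$ can be obtained from $G$ by a sequence of vertex deletions and edge pivots. For a graph $H$, $\mathcal{F}_H$ is the set of induced-subgraph-minimal graphs containing a pivot-minor isomorphic to $H$: a graph $F$ is in $\mathcal{F}_H$ if and only if $F$ contains a pivot-minor isomorphic to $H$ but no proper induced subgraph of $F$ does. $K_4$ is the complete graph on four vertices. -}

module Defs where

open import Data.Bool.Base using (Bool; true; false; _∧_; not; _xor_)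
open import Data.Bool.Properties using (∧-comm; ∧-zeroʳ)
open import Data.Fin.Base using (Fin; zero; suc; punchIn)
open import Data.Fin.Properties using (_≟_)
open import Data.Fin.Subset using (Subset; inside; outside; ⊤; ∣_∣; _⊂_)
open import Data.Nat.Base using (ℕ; suc)
open import Data.Product.Base using (_×_; Σ-syntax; ∃-syntax)
open import Data.Vec.Base using ([]; _∷_)
open import Function.Base using (_∘_)
open import Function.Bundles using (_↔_; module Inverse)
open import Relation.Binary.PropositionalEquality
  using (_≡_; refl; sym; cong₂)
open import Relation.Nullary using (¬_; does; yes; no; contradiction)

record Graph (n : ℕ) : Set where
  field
    adj        : Fin n → Fin n → Bool
    adj-sym    : ∀ x y → adj x y ≡ adj y x
    adj-irrefl : ∀ x → adj x x ≡ false

open Graph public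

private
  variable
    k m n : ℕ

distinct : Fin n → Fin n → Bool
distinct x y = not (does (x ≟ y))

distinct-sym : (x y : Fin n) → distinct x y ≡ distinct y x
distinct-sym x y with x ≟ y | y ≟ x
... | yes _   | yes _   = refl
... | no  _   | no  _   = refl
... | yes x≡y | no  y≢x = contradiction (sym x≡y) y≢x
... | no  x≢y | yes y≡x = contradiction (sym y≡x) x≢y

distinct-irrefl : (x : Fin n) → distinct x x ≡ false
distinct-irrefl x with x ≟ x
... | yes _   = refl
... | no  x≢x = contradiction refl x≢x

complete : ∀ n → Graph n
complete n = record
  { adj        = distinct
  ; adj-sym    = distinct-sym
  ; adj-irrefl = distinct-irrefl
  }

K₄ : Graph 4
K₄ = complete 4

record _≅_ (G : Graph m) (H : Graph n) : Set where
  field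
    bijection : Fin m ↔ Fin n
    preserves : ∀ x y →
      adj G x y ≡ adj H (Inverse.to bijection x) (Inverse.to bijection y)

infix 4 _≅_

-- The graph on Fin k in which x, y are adjacent iff f x, f y are adjacent in
-- G.  Used below only with f injective.
pullback : (Fin k → Fin n) → Graph n → Graph k
pullback f G = record
  { adj        = λ x y → adj G (f x) (f y)
  ; adj-sym    = λ x y → adj-sym G (f x) (f y)
  ; adj-irrefl = λ x → adj-irrefl G (f x)
  }

-- The elements of S in increasing order.
enumerate : (S : Subset n) → Fin ∣ S ∣ → Fin n
enumerate (inside  ∷ S) zero    = zero
enumerate (inside  ∷ S) (suc i) = suc (enumerate S i)
enumerate (outside ∷ S) i       = suc (enumerate S i)

-- Induced subgraph, with the vertices in S renumbered in increasing order.
_[_] : Graph n → (S : Subset n) → Graph ∣ S ∣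
G [ S ] = pullback (enumerate S) G

infixl 8 _[_]

-- Vertex deletion; punchIn v enumerates the vertices other than v.
_∖_ : Graph (suc n) → Fin (suc n) → Graph n
G ∖ v = pullback (punchIn v) G

infixl 7 _∖_

-- Local complementation: adjacency of x and y is flipped exactly when x and y
-- are distinct neighbours of u.
_*_ : Graph n → Fin n → Graph n
G * u = record
  { adj        = λ x y → adj G x y xor ((adj G u x ∧ adj G u y) ∧ distinct x y)
  ; adj-sym    = λ x y → cong₂ _xor_ (adj-sym G x y)
                   (cong₂ _∧_ (∧-comm (adj G u x) (adj G u y)) (distinct-sym x y))
  ; adj-irrefl = irrefl
  }
  where
  irrefl : ∀ x → adj G x x xor ((adj G u x ∧ adj G u x) ∧ distinct x x) ≡ false
  irrefl x rewrite adj-irrefl G x | distinct-irrefl x =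
    ∧-zeroʳ (adj G u x ∧ adj G u x)

infixl 7 _*_

-- Meaningful only when uv is an edge of G, which is required wherever it is used.
pivot : Graph n → Fin n → Fin n → Graph n
pivot G u v = ((G * u) * v) * u

-- G ⇝ H: the labelled graph H arises from G by a finite (possibly empty)
-- sequence of vertex deletions and edge pivots.
data _⇝_ (G : Graph m) : {n : ℕ} → Graph n → Set where
  start      : G ⇝ G
  thenDelete : {H : Graph (suc n)} → G ⇝ H → (v : Fin (suc n)) → G ⇝ H ∖ v
  thenPivot  : {H : Graph n} → G ⇝ H → (u v : Fin n) → adj H u v ≡ true →
               G ⇝ pivot H u v

infix 4 _⇝_

HasPivotMinor : Graph m → Graph n → Set
HasPivotMinor G H = ∃[ k ] Σ[ P ∈ Graph k ] (G ⇝ P × P ≅ H)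

-- Membership of F in the class 𝓕_H.
𝓕 : Graph m → Graph n → Set
𝓕 H F = HasPivotMinor F H × (∀ S → S ⊂ ⊤ → ¬ HasPivotMinor (F [ S ]) H)

{-# OPTIONS --safe #-}

-- The graphs are the odd cycles with one vertex replaced by two adjacent twins,
-- that is, K₄ with one edge replaced by a path of odd length.  Pivoting on an
-- edge inside the path and deleting its ends shortens the path by two, which
-- leads down to K₄.
--
-- For minimality, a graph with adjacency matrix A is viewed as the space of
-- pairs (x , A x) over 𝔽₂.  A pivot on uv swaps the two components at u and at
-- v, and a deletion restricts to the pairs whose first component vanishes there.
-- So if K₄ is a pivot-minor of G, then every two terminals i, j carry a vector z
-- on G with (z , A z) = (1 , 1) at i and j, (0 , 0) at the other two terminals,
-- and one component zero at each deleted vertex.  Fix such vectors z for i, j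
-- and z′ for i, l.  For a 2-colouring f, the sum over all a, b of z a A a b z′ b
-- (if f a) or z′ a A a b z b (otherwise) is 1, computed row by row.  If G is
-- bipartite apart from edges at which z a z′ b = z b z′ a, then it is symmetric
-- in a and b, so it is 0.  Deleting a vertex from a twinned cycle always leaves
-- such a colouring for suitable terminals.
module Submission where

open import Defs
open import Algebra.Bundles using (CommutativeRing)
import Data.Bool.Properties as Bool
open import Data.Bool.Base using (Bool; true; false; _∧_; _∨_; not; _xor_; if_then_else_; T)
open import Data.Bool.Properties
  using (xor-∧-commutativeRing; xor-same; xor-identityʳ; xor-assoc; xor-annihilates-not;
         not-distribˡ-xor; ∧-distribˡ-xor; ∧-distribʳ-xor; ∧-assoc; ∧-comm; ∧-zeroʳ;
         ∨-comm; if-eta; not-involutive; not-¬; T-≡; T-∨; T-∧)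
open import Data.Empty using (⊥)
open import Data.Fin.Base using (Fin; zero; suc; punchIn; punchOut; toℕ)
open import Data.Fin.Permutation using (↔⇒≡)
open import Data.Fin.Properties
  using (_≟_; any?; all?; suc-injective; toℕ-injective; punchIn-punchOut)
open import Data.Fin.Subset using (Subset; inside; outside; ⊤; ∣_∣; _∈_; _∉_; _⊂_)
open import Data.Nat.Base
  using (ℕ; zero; suc; _+_; _⊓_; ∣_-_∣; _≤_; _<_; _≤ᵇ_; _<ᵇ_; _≡ᵇ_)
import Data.Nat.Properties as ℕ
open import Data.Nat.Properties
  using (∣-∣-comm; ∣n-n∣≡0; ≡ᵇ⇒≡; <⇒<ᵇ; ≤∧≢⇒<; m⊓n≤n; ⊓-sel)
open import Data.Product.Base using (_×_; _,_; proj₁; proj₂; swap; Σ-syntax; ∃-syntax)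
open import Data.Sum.Base as Sum using (_⊎_; inj₁; inj₂)
open import Data.Vec.Base using ([]; _∷_; here; there)
open import Data.Vec.Functional using (insertAt)
open import Data.Vec.Functional.Properties using (insertAt-lookup; insertAt-punchIn)
open import Function.Base using (_∘_)
open import Function.Bundles using (module Inverse; module Equivalence)
open import Function.Construct.Identity using (↔-id)
open import Relation.Binary.PropositionalEquality
  using (_≡_; _≢_; refl; sym; trans; cong; cong₂; subst; module ≡-Reasoning)
open import Relation.Nullary using (¬_; Dec; does; yes; no; contradiction)
open import Relation.Nullary.Decidable using (dec-true; dec-false; from-yes)
open import Algebra.Properties.Semiring.Sum (CommutativeRing.semiring xor-∧-commutativeRing)
  using (sum; sum-cong-≗; ∑-distrib-+; *-distribˡ-sum; sum-remove)

private
  variable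
    k m n : ℕ

-- Finite sums over 𝔽₂

δ : Fin n → Fin n → Bool
δ u j = does (u ≟ j)

sum-false : (f : Fin n → Bool) → (∀ j → f j ≡ false) → sum f ≡ false
sum-false {zero}  f f≡0 = refl
sum-false {suc n} f f≡0 = cong₂ _xor_ (f≡0 zero) (sum-false (f ∘ suc) (f≡0 ∘ suc))

sum-single : (f : Fin n → Bool) (u : Fin n) → (∀ j → j ≢ u → f j ≡ false) → sum f ≡ f u
sum-single {suc n} f zero f≡0 = trans
  (cong (f zero xor_) (sum-false (f ∘ suc) λ j → f≡0 (suc j) λ ()))
  (xor-identityʳ (f zero))
sum-single {suc n} f (suc u) f≡0 = cong₂ _xor_ (f≡0 zero λ ())
  (sum-single (f ∘ suc) u λ j j≢u → f≡0 (suc j) (j≢u ∘ suc-injective))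

sum-∧-δ : (f : Fin n → Bool) (u : Fin n) → sum (λ j → f j ∧ δ u j) ≡ f u
sum-∧-δ f u = trans
  (sum-single _ u λ j j≢u → trans
    (cong (f j ∧_) (dec-false (u ≟ j) (j≢u ∘ sym))) (∧-zeroʳ (f j)))
  (trans (cong (f u ∧_) (dec-true (u ≟ u) refl)) (∧-comm (f u) true))

-- Over 𝔽₂ the entries at (a , b) and (b , a) cancel. The induction splits off the first row and the
-- first column, which are equal beyond the diagonal.
sum-alternating : (S : Fin n → Fin n → Bool) →
  (∀ a b → S a b ≡ S b a) → (∀ a → S a a ≡ false) →
  sum (λ a → sum (S a)) ≡ false
sum-alternating {zero}  S S-sym S-irrefl = refl
sum-alternating {suc n} S S-sym S-irrefl = begin
  (S zero zero xor row) xor sum (λ a → S (suc a) zero xor sum (S (suc a) ∘ suc))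
    ≡⟨ cong₂ _xor_ (cong (_xor row) (S-irrefl zero))
         (∑-distrib-+ (λ a → S (suc a) zero) (λ a → sum (S (suc a) ∘ suc))) ⟩
  row xor (sum (λ a → S (suc a) zero) xor sum (λ a → sum (S (suc a) ∘ suc)))
    ≡⟨ cong (row xor_) (cong₂ _xor_
         (sum-cong-≗ λ a → S-sym (suc a) zero)
         (sum-alternating (λ a b → S (suc a) (suc b))
           (λ a b → S-sym (suc a) (suc b)) (S-irrefl ∘ suc))) ⟩
  row xor (row xor false)
    ≡⟨ cong (row xor_) (xor-identityʳ row) ⟩
  row xor row
    ≡⟨ xor-same row ⟩
  false ∎
  where
  open ≡-Reasoning
  row = sum (S zero ∘ suc)

-- Local complementation and pivoting as changes of coordinates

neighbourSum : Graph n → (Fin n → Bool) → Fin n → Bool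
neighbourSum G x i = sum λ j → adj G i j ∧ x j

neighbourSum-xor : (G : Graph n) (x x′ : Fin n → Bool) (i : Fin n) →
  neighbourSum G (λ j → x j xor x′ j) i ≡ neighbourSum G x i xor neighbourSum G x′ i
neighbourSum-xor G x x′ i = trans
  (sum-cong-≗ λ j → ∧-xor (adj G i j) (x j) (x′ j))
  (∑-distrib-+ (λ j → adj G i j ∧ x j) (λ j → adj G i j ∧ x′ j))
  where
  ∧-xor : ∀ a b c → a ∧ (b xor c) ≡ (a ∧ b) xor (a ∧ c)
  ∧-xor false b c = refl
  ∧-xor true  b c = refl

-- A neighbour `i` of `u` has its adjacency flipped to every neighbour of `u` except itself. The
-- inner term `adj G u i ∧ x i` takes `i` back out of the sum at `u`.
neighbourSum-* : (G : Graph n) (u : Fin n) (x : Fin n → Bool) (i : Fin n) →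
  neighbourSum (G * u) x i ≡
  neighbourSum G x i xor (adj G u i ∧ (neighbourSum G x u xor (adj G u i ∧ x i)))
neighbourSum-* G u x i = begin
  neighbourSum (G * u) x i
    ≡⟨ sum-cong-≗ (λ j → expand (adj G i j) (adj G u i) (adj G u j) (δ i j) (x j)) ⟩
  sum (λ j → (adj G i j ∧ x j) xor (adj G u i ∧ (ux j xor (ux j ∧ δ i j))))
    ≡⟨ ∑-distrib-+ (λ j → adj G i j ∧ x j) _ ⟩
  neighbourSum G x i xor sum (λ j → adj G u i ∧ (ux j xor (ux j ∧ δ i j)))
    ≡⟨ cong (neighbourSum G x i xor_) (sym (*-distribˡ-sum (adj G u i) λ j → ux j xor (ux j ∧ δ i j))) ⟩
  neighbourSum G x i xor (adj G u i ∧ sum (λ j → ux j xor (ux j ∧ δ i j)))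
    ≡⟨ cong (λ s → neighbourSum G x i xor (adj G u i ∧ s)) (trans
         (∑-distrib-+ ux (λ j → ux j ∧ δ i j))
         (cong (sum ux xor_) (sum-∧-δ ux i))) ⟩
  neighbourSum G x i xor (adj G u i ∧ (neighbourSum G x u xor (adj G u i ∧ x i))) ∎
  where
  open ≡-Reasoning
  ux : Fin _ → Bool
  ux j = adj G u j ∧ x j
  expand : ∀ a b c d y →
    (a xor ((b ∧ c) ∧ not d)) ∧ y ≡ (a ∧ y) xor (b ∧ ((c ∧ y) xor ((c ∧ y) ∧ d)))
  expand false false _     _     _     = refl
  expand false true  false _     _     = refl
  expand false true  true  false false = refl
  expand false true  true  false true  = refl
  expand false true  true  true  false = refl
  expand false true  true  true  true  = refl
  expand true  false _     _     false = refl
  expand true  false _     _     true  = refl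
  expand true  true  false _     false = refl
  expand true  true  false _     true  = refl
  expand true  true  true  false false = refl
  expand true  true  true  false true  = refl
  expand true  true  true  true  false = refl
  expand true  true  true  true  true  = refl

-- Writes a vector on G * u in terms of one on G: the pair (x , A x) is sheared
-- at u and, the other way, at the neighbours of u.
record Shear (G : Graph n) (u : Fin n) (x : Fin n → Bool) : Set where
  field
    vector  : Fin n → Bool
    at-u    : vector u ≡ x u xor neighbourSum (G * u) x u
    off-u   : ∀ i → i ≢ u → vector i ≡ x i
    sums    : ∀ i → neighbourSum G vector i ≡ neighbourSum (G * u) x i xor (adj G u i ∧ x i)

shear : (G : Graph n) (u : Fin n) (x : Fin n → Bool) → Shear G u x
shear G u x = record
  -- `s` is the sum at `u`, the same in `G` and in `G * u` since `u` is not its own neighbour.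
  -- Adding it at `u` reproduces in `G` the term `adj G u i ∧ s` that local complementation
  -- contributes, leaving only the diagonal correction.
  { vector = λ j → x j xor (s ∧ δ u j)
  ; at-u   = cong (x u xor_) (trans
      (cong (s ∧_) (dec-true (u ≟ u) refl)) (trans (∧-comm s true) (sym s-*)))
  ; off-u  = λ i i≢u → trans
      (cong (λ d → x i xor (s ∧ d)) (dec-false (u ≟ i) (i≢u ∘ sym)))
      (trans (cong (x i xor_) (∧-zeroʳ s)) (xor-identityʳ (x i)))
  ; sums   = λ i → begin
      neighbourSum G (λ j → x j xor (s ∧ δ u j)) i
        ≡⟨ neighbourSum-xor G x (λ j → s ∧ δ u j) i ⟩
      neighbourSum G x i xor sum (λ j → adj G i j ∧ (s ∧ δ u j))
        ≡⟨ cong (neighbourSum G x i xor_) (trans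
             (sum-cong-≗ λ j → sym (∧-assoc (adj G i j) s (δ u j)))
             (trans (sum-∧-δ (λ j → adj G i j ∧ s) u)
               (cong (_∧ s) (adj-sym G i u)))) ⟩
      neighbourSum G x i xor (adj G u i ∧ s)
        ≡⟨ rearrange (neighbourSum G x i) (adj G u i) s (x i) ⟩
      (neighbourSum G x i xor (adj G u i ∧ (s xor (adj G u i ∧ x i)))) xor (adj G u i ∧ x i)
        ≡⟨ cong (_xor (adj G u i ∧ x i)) (sym (neighbourSum-* G u x i)) ⟩
      neighbourSum (G * u) x i xor (adj G u i ∧ x i) ∎
  }
  where
  open ≡-Reasoning
  s = neighbourSum G x u
  s-* : neighbourSum (G * u) x u ≡ s
  s-* = trans (neighbourSum-* G u x u) (trans
    (cong (λ a → s xor (a ∧ (s xor (a ∧ x u)))) (adj-irrefl G u)) (xor-identityʳ s))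
  rearrange : ∀ y a t z → y xor (a ∧ t) ≡ (y xor (a ∧ (t xor (a ∧ z)))) xor (a ∧ z)
  rearrange false false _     _     = refl
  rearrange true  false _     _     = refl
  rearrange false true  false false = refl
  rearrange false true  false true  = refl
  rearrange false true  true  false = refl
  rearrange false true  true  true  = refl
  rearrange true  true  false false = refl
  rearrange true  true  false true  = refl
  rearrange true  true  true  false = refl
  rearrange true  true  true  true  = refl

*-adj-self : (G : Graph n) (u i : Fin n) → adj (G * u) u i ≡ adj G u i
*-adj-self G u i rewrite adj-irrefl G u = xor-identityʳ (adj G u i)

*-adj-neighbour : (G : Graph n) {u v : Fin n} → adj G u v ≡ true → (i : Fin n) → i ≢ v →
  adj (G * u) v i ≡ adj G v i xor adj G u i
*-adj-neighbour G {u} {v} uv i i≢v rewrite uv | dec-false (v ≟ i) (i≢v ∘ sym) =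
  cong (adj G v i xor_) (∧-comm (adj G u i) true)

coordinate : Graph n → (Fin n → Bool) → Fin n → Bool × Bool
coordinate G x i = x i , neighbourSum G x i

swapIf : Bool → Bool × Bool → Bool × Bool
swapIf b p = if b then swap p else p

swapIf-xor : ∀ b c p → swapIf b (swapIf c p) ≡ swapIf (b xor c) p
swapIf-xor false c     p = refl
swapIf-xor true  false p = refl
swapIf-xor true  true  p = refl

-- The three local complementations are undone by three shears. At `u` and at `v` these alternate
-- between the two components and so exchange them, as three xors exchange two bits. At any other
-- vertex only the second component is sheared, with coefficients q, q + p and p, where p and q are
-- the adjacencies to `u` and `v` in `G`; these add up to zero.
unpivot : (G : Graph n) (u v : Fin n) → adj G u v ≡ true → (x : Fin n → Bool) →
  ∃[ x′ ] ∀ i → coordinate G x′ i ≡ swapIf (δ u i xor δ v i) (coordinate (pivot G u v) x i)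
unpivot G u v uv x = vector S₀ , λ i → correct i (u ≟ i) (v ≟ i)
  where
  open Shear
  G₁ = G * u
  G₂ = G₁ * v
  S₂ = shear G₂ u x
  S₁ = shear G₁ v (vector S₂)
  S₀ = shear G u (vector S₁)
  y : Fin _ → Bool
  y = neighbourSum (pivot G u v) x

  u≢v : u ≢ v
  u≢v refl with () ← trans (sym uv) (adj-irrefl G u)
  v₁u : adj G₁ v u ≡ true
  v₁u = trans (adj-sym G₁ v u) (trans (*-adj-self G u v) uv)
  v₁ : ∀ i → i ≢ v → adj G₁ v i ≡ adj G v i xor adj G u i
  v₁ = *-adj-neighbour G uv
  u₂ : ∀ i → i ≢ u → adj G₂ u i ≡ adj G u i xor adj G₁ v i
  u₂ i i≢u = trans (*-adj-neighbour G₁ v₁u i i≢u)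
    (cong (_xor adj G₁ v i) (*-adj-self G u i))

  at-u₀ : coordinate G (vector S₀) u ≡ swap (x u , y u)
  at-u₀ = combine (at-u S₂) (sums S₂ u) (adj-irrefl G₂ u) (off-u S₁ u u≢v) (sums S₁ u) v₁u
                  (at-u S₀) (sums S₀ u) (adj-irrefl G u)
    where
    combine : ∀ {x y x₀ y₀ x₁ y₁ x₂ y₂ a₀ a₁ a₂} →
      x₂ ≡ x xor y → y₂ ≡ y xor (a₂ ∧ x) → a₂ ≡ false →
      x₁ ≡ x₂ → y₁ ≡ y₂ xor (a₁ ∧ x₂) → a₁ ≡ true →
      x₀ ≡ x₁ xor y₁ → y₀ ≡ y₁ xor (a₀ ∧ x₁) → a₀ ≡ false →
      (x₀ , y₀) ≡ (y , x)
    combine {false} {false} refl refl refl refl refl refl refl refl refl = refl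
    combine {false} {true}  refl refl refl refl refl refl refl refl refl = refl
    combine {true}  {false} refl refl refl refl refl refl refl refl refl = refl
    combine {true}  {true}  refl refl refl refl refl refl refl refl refl = refl

  at-v₀ : coordinate G (vector S₀) v ≡ swap (x v , y v)
  at-v₀ = combine (off-u S₂ v v≢u) (sums S₂ v) (trans (u₂ v v≢u) (cong₂ _xor_ uv (adj-irrefl G₁ v)))
                  (at-u S₁) (sums S₁ v) (adj-irrefl G₁ v)
                  (off-u S₀ v v≢u) (sums S₀ v) uv
    where
    v≢u : v ≢ u
    v≢u = u≢v ∘ sym
    combine : ∀ {x y x₀ y₀ x₁ y₁ x₂ y₂ a₀ a₁ a₂} →
      x₂ ≡ x → y₂ ≡ y xor (a₂ ∧ x) → a₂ ≡ true →
      x₁ ≡ x₂ xor y₂ → y₁ ≡ y₂ xor (a₁ ∧ x₂) → a₁ ≡ false →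
      x₀ ≡ x₁ → y₀ ≡ y₁ xor (a₀ ∧ x₁) → a₀ ≡ true →
      (x₀ , y₀) ≡ (y , x)
    combine {false} {false} refl refl refl refl refl refl refl refl refl = refl
    combine {false} {true}  refl refl refl refl refl refl refl refl refl = refl
    combine {true}  {false} refl refl refl refl refl refl refl refl refl = refl
    combine {true}  {true}  refl refl refl refl refl refl refl refl refl = refl

  off-uv : ∀ i → i ≢ u → i ≢ v → coordinate G (vector S₀) i ≡ (x i , y i)
  off-uv i i≢u i≢v = combine {q = adj G v i} (off-u S₂ i i≢u) (sums S₂ i) (u₂ i i≢u)
                             (off-u S₁ i i≢v) (sums S₁ i) (v₁ i i≢v)
                             (off-u S₀ i i≢u) (sums S₀ i)
    where
    combine : ∀ {x y x₀ y₀ x₁ y₁ x₂ y₂ a₁ a₂ p q} →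
      x₂ ≡ x → y₂ ≡ y xor (a₂ ∧ x) → a₂ ≡ p xor a₁ →
      x₁ ≡ x₂ → y₁ ≡ y₂ xor (a₁ ∧ x₂) → a₁ ≡ q xor p →
      x₀ ≡ x₁ → y₀ ≡ y₁ xor (p ∧ x₁) →
      (x₀ , y₀) ≡ (x , y)
    combine {x} {y} {p = p} {q} refl refl refl refl refl refl refl refl =
      cong (x ,_) (bits p q x y)
      where
      bits : ∀ p q a b →
        ((b xor ((p xor (q xor p)) ∧ a)) xor ((q xor p) ∧ a)) xor (p ∧ a) ≡ b
      bits false false _     false = refl
      bits false false _     true  = refl
      bits false true  false false = refl
      bits false true  false true  = refl
      bits false true  true  false = refl
      bits false true  true  true  = refl
      bits true  false false false = refl
      bits true  false false true  = refl
      bits true  false true  false = refl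
      bits true  false true  true  = refl
      bits true  true  false false = refl
      bits true  true  false true  = refl
      bits true  true  true  false = refl
      bits true  true  true  true  = refl

  correct : ∀ i → Dec (u ≡ i) → Dec (v ≡ i) →
    coordinate G (vector S₀) i ≡ swapIf (δ u i xor δ v i) (x i , y i)
  correct i (yes refl) _ = trans at-u₀ (cong₂ (λ b c → swapIf (b xor c) (x u , y u))
    (sym (dec-true (u ≟ u) refl)) (sym (dec-false (v ≟ u) (u≢v ∘ sym))))
  correct i (no _) (yes refl) = trans at-v₀ (cong₂ (λ b c → swapIf (b xor c) (x v , y v))
    (sym (dec-false (u ≟ v) u≢v)) (sym (dec-true (v ≟ v) refl)))
  correct i (no u≢i) (no v≢i) = trans (off-uv i (u≢i ∘ sym) (v≢i ∘ sym))
    (cong₂ (λ b c → swapIf (b xor c) (x i , y i))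
      (sym (dec-false (u ≟ i) u≢i)) (sym (dec-false (v ≟ i) v≢i)))

-- Lifting vectors from a pivot-minor to the original graph

-- Vertices of G outside the image of embed are deleted: slot j selects which
-- component of the pair at j must vanish.  The vertex v is one at which every
-- lift has first component zero, whatever slot v is.
record Lift (G : Graph m) (v : Fin m) (H : Graph n) (embed : Fin n → Fin m)
            (twist : Fin n → Bool) (slot : Fin m → Bool) (x : Fin n → Bool) : Set where
  field
    vector : Fin m → Bool
    on     : ∀ i → coordinate G vector (embed i) ≡ swapIf (twist i) (coordinate H x i)
    off    : ∀ j → (∀ i → embed i ≢ j) → proj₁ (swapIf (slot j) (coordinate G vector j)) ≡ false
    avoids : vector v ≡ false

-- `embed`, `twist` and `slot` are chosen before `x`, so all lifts vanish in the same component at a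
-- deleted vertex. This makes products of two different lifts vanish there later on.
record Represents (G : Graph m) (v : Fin m) (H : Graph n) : Set where
  field
    embed : Fin n → Fin m
    twist : Fin n → Bool
    slot  : Fin m → Bool
    lift  : ∀ x → Lift G v H embed twist slot x

enumerate-∈ : (S : Subset n) (i : Fin ∣ S ∣) → enumerate S i ∈ S
enumerate-∈ (inside  ∷ S) zero    = here
enumerate-∈ (inside  ∷ S) (suc i) = there (enumerate-∈ S i)
enumerate-∈ (outside ∷ S) i       = there (enumerate-∈ S i)

extendByFalse : (S : Subset n) → (Fin ∣ S ∣ → Bool) → Fin n → Bool
extendByFalse (inside  ∷ S) x zero    = x zero
extendByFalse (inside  ∷ S) x (suc j) = extendByFalse S (x ∘ suc) j
extendByFalse (outside ∷ S) x zero    = false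
extendByFalse (outside ∷ S) x (suc j) = extendByFalse S x j

extendByFalse-enumerate : (S : Subset n) (x : Fin ∣ S ∣ → Bool) (i : Fin ∣ S ∣) →
  extendByFalse S x (enumerate S i) ≡ x i
extendByFalse-enumerate (inside  ∷ S) x zero    = refl
extendByFalse-enumerate (inside  ∷ S) x (suc i) = extendByFalse-enumerate S (x ∘ suc) i
extendByFalse-enumerate (outside ∷ S) x i       = extendByFalse-enumerate S x i

extendByFalse-off : (S : Subset n) (x : Fin ∣ S ∣ → Bool) (j : Fin n) →
  (∀ i → enumerate S i ≢ j) → extendByFalse S x j ≡ false
extendByFalse-off (inside  ∷ S) x zero    off = contradiction refl (off zero)
extendByFalse-off (inside  ∷ S) x (suc j) off =
  extendByFalse-off S (x ∘ suc) j λ i e → off (suc i) (cong suc e)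
extendByFalse-off (outside ∷ S) x zero    off = refl
extendByFalse-off (outside ∷ S) x (suc j) off =
  extendByFalse-off S x j λ i e → off i (cong suc e)

sum-extendByFalse : (S : Subset n) (a : Fin n → Bool) (x : Fin ∣ S ∣ → Bool) →
  sum (λ j → a j ∧ extendByFalse S x j) ≡ sum (λ i → a (enumerate S i) ∧ x i)
sum-extendByFalse []            a x = refl
sum-extendByFalse (inside  ∷ S) a x =
  cong ((a zero ∧ x zero) xor_) (sum-extendByFalse S (a ∘ suc) (x ∘ suc))
sum-extendByFalse (outside ∷ S) a x =
  cong₂ _xor_ (∧-zeroʳ (a zero)) (sum-extendByFalse S (a ∘ suc) x)

represents-induced : (G : Graph m) (v : Fin m) (S : Subset m) → v ∉ S →
  Represents G v (G [ S ])
represents-induced G v S v∉S = record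
  { embed = enumerate S
  ; twist = λ _ → false
  ; slot  = λ _ → false
  ; lift  = λ x → record
      { vector = extendByFalse S x
      ; on     = λ i → cong₂ _,_ (extendByFalse-enumerate S x i)
                   (sum-extendByFalse S (adj G (enumerate S i)) x)
      ; off    = extendByFalse-off S x
      ; avoids = extendByFalse-off S x v λ i e → v∉S (subst (_∈ S) e (enumerate-∈ S i))
      }
  }

-- By `unpivot` each vector on the pivot comes from a vector on `H`, whose lift is reused. Only the
-- record of exchanged components changes, at `a` and `b`.
represents-pivot : {G : Graph m} {v : Fin m} {H : Graph n} (a b : Fin n) →
  adj H a b ≡ true → Represents G v H → Represents G v (pivot H a b)
represents-pivot {H = H} a b ab R = record
  { embed = embed
  ; twist = λ i → twist i xor (δ a i xor δ b i)
  ; slot  = slot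
  ; lift  = λ x →
      let (x′ , x′≡) = unpivot H a b ab x
          open Lift (lift x′)
      in record
      { vector = vector
      ; on     = λ i → trans (on i) (trans
          (cong (swapIf (twist i)) (x′≡ i)) (swapIf-xor (twist i) _ _))
      ; off    = off
      ; avoids = avoids
      }
  }
  where open Represents R

neighbourSum-insertAt : (H : Graph (suc n)) (u : Fin (suc n)) (x : Fin n → Bool) (i : Fin n) →
  neighbourSum H (insertAt x u false) (punchIn u i) ≡ neighbourSum (H ∖ u) x i
neighbourSum-insertAt H u x i = trans
  (sum-remove {i = u} (λ j → adj H (punchIn u i) j ∧ insertAt x u false j))
  (cong₂ _xor_
    (trans (cong (adj H (punchIn u i) u ∧_) (insertAt-lookup x u false)) (∧-zeroʳ _))
    (sum-cong-≗ λ j → cong (adj H (punchIn u i) (punchIn u j) ∧_)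
      (insertAt-punchIn x u false j)))

represents-delete : {G : Graph m} {v : Fin m} {H : Graph (suc n)} (u : Fin (suc n)) →
  Represents G v H → Represents G v (H ∖ u)
represents-delete {m = m} {n} {G} {v} {H} u R = record
  { embed = embed ∘ punchIn u
  ; twist = twist ∘ punchIn u
  ; slot  = newSlot
  ; lift  = λ x → let open Lift (lift (insertAt x u false)) in record
      { vector = vector
      ; on     = λ i → trans (on (punchIn u i)) (cong (swapIf (twist (punchIn u i)))
          (cong₂ _,_ (insertAt-punchIn x u false i) (neighbourSum-insertAt H u x i)))
      ; off    = newOff x
      ; avoids = avoids
      }
  }
  where
  open Represents R
  newSlot : Fin m → Bool
  -- Deletion forces the first component in `H` to vanish at `u`. On `G` this is the component
  -- selected by the twist that `u` has accumulated so far.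
  newSlot j = if δ (embed u) j then twist u else slot j

  newOff : ∀ x j → (∀ i → embed (punchIn u i) ≢ j) →
    proj₁ (swapIf (newSlot j) (coordinate G (Lift.vector (lift (insertAt x u false))) j)) ≡ false
  newOff x j ∉punchIn with embed u ≟ j
  ... | yes refl = begin
        proj₁ (swapIf (twist u) (coordinate G vector (embed u)))
          ≡⟨ cong (proj₁ ∘ swapIf (twist u)) (on u) ⟩
        proj₁ (swapIf (twist u) (swapIf (twist u) (coordinate H (insertAt x u false) u)))
          ≡⟨ cong proj₁ (trans (swapIf-xor (twist u) (twist u) _)
               (cong (λ b → swapIf b _) (xor-same (twist u)))) ⟩
        insertAt x u false u
          ≡⟨ insertAt-lookup x u false ⟩
        false ∎
    where
    open ≡-Reasoning
    open Lift (lift (insertAt x u false))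
  ... | no u≢j = Lift.off (lift (insertAt x u false)) j λ i e → helper i e (u ≟ i)
    where
    helper : ∀ i → embed i ≡ j → ¬ Dec (u ≡ i)
    helper i e (yes refl) = u≢j e
    helper i e (no u≢i)   = ∉punchIn (punchOut u≢i) (trans (cong embed (punchIn-punchOut u≢i)) e)

represents-⇝ : {G : Graph k} {v : Fin k} {H : Graph m} {P : Graph n} →
  Represents G v H → H ⇝ P → Represents G v P
represents-⇝ R start                  = R
represents-⇝ R (thenDelete H⇝P u)     = represents-delete u (represents-⇝ R H⇝P)
represents-⇝ R (thenPivot H⇝P a b ab) = represents-pivot a b ab (represents-⇝ R H⇝P)

-- Certificates for a K₄ pivot-minor

record K₄Certificate (G : Graph m) (v : Fin m) : Set where
  field
    terminal : Fin 4 → Fin m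
    slot     : Fin m → Bool
    vector   : Fin 4 → Fin 4 → Fin m → Bool
    on       : ∀ i j l → vector i j (terminal l) ≡ δ i l xor δ j l
    on-sum   : ∀ i j l → neighbourSum G (vector i j) (terminal l) ≡ δ i l xor δ j l
    off      : ∀ i j a → (∀ l → terminal l ≢ a) →
               proj₁ (swapIf (slot a) (coordinate G (vector i j) a)) ≡ false
    avoids   : ∀ i j → vector i j v ≡ false

-- In K₄ the column of `i` is the all-ones vector plus the unit vector at `i`, so the adjacency
-- matrix fixes the sum of the unit vectors at `i` and `j`. The two components of its pairs
-- therefore agree, and exchanging them by `twist` has no effect: the certificate need not mention
-- `twist`.
certificate : {G : Graph m} {v : Fin m} {P : Graph n} →
  Represents G v P → P ≅ K₄ → K₄Certificate G v
certificate {G = G} {P = P} R P≅K₄ = record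
  { terminal = embed ∘ from
  ; slot     = slot
  ; vector   = λ i j → Lift.vector (lift (x i j))
  ; on       = λ i j l → cong proj₁ (on-terminal i j l)
  ; on-sum   = λ i j l → cong proj₂ (on-terminal i j l)
  ; off      = λ i j a ∉terminal → Lift.off (lift (x i j)) a λ b e →
                 ∉terminal (to b) (trans (cong embed (strictlyInverseʳ b)) e)
  ; avoids   = λ i j → Lift.avoids (lift (x i j))
  }
  where
  open Represents R
  open _≅_ P≅K₄
  open Inverse bijection using (to; from; strictlyInverseˡ; strictlyInverseʳ)
  x : Fin 4 → Fin 4 → Fin _ → Bool
  x i j a = δ (from i) a xor δ (from j) a

  δ-from : ∀ i l → δ (from i) (from l) ≡ δ i l
  δ-from i l with i ≟ l
  ... | yes refl = dec-true (from i ≟ from i) refl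
  ... | no i≢l   = dec-false (from i ≟ from l) λ e →
          i≢l (trans (sym (strictlyInverseˡ i)) (trans (cong to e) (strictlyInverseˡ l)))

  adj-from : ∀ i l → adj P (from l) (from i) ≡ not (δ i l)
  adj-from i l = trans (preserves (from l) (from i)) (trans
    (cong₂ distinct (strictlyInverseˡ l) (strictlyInverseˡ i)) (distinct-sym l i))

  sum-from : ∀ i j l → neighbourSum P (x i j) (from l) ≡ δ i l xor δ j l
  sum-from i j l = begin
    neighbourSum P (x i j) (from l)
      ≡⟨ neighbourSum-xor P (δ (from i)) (δ (from j)) (from l) ⟩
    neighbourSum P (δ (from i)) (from l) xor neighbourSum P (δ (from j)) (from l)
      ≡⟨ cong₂ _xor_ (sum-∧-δ (adj P (from l)) (from i)) (sum-∧-δ (adj P (from l)) (from j)) ⟩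
    adj P (from l) (from i) xor adj P (from l) (from j)
      ≡⟨ cong₂ _xor_ (adj-from i l) (adj-from j l) ⟩
    not (δ i l) xor not (δ j l)
      ≡⟨ xor-annihilates-not (δ i l) (δ j l) ⟩
    δ i l xor δ j l ∎
    where open ≡-Reasoning

  swapIf-diagonal : ∀ t b → swapIf t (b , b) ≡ (b , b)
  swapIf-diagonal false b = refl
  swapIf-diagonal true  b = refl

  on-terminal : ∀ i j l → coordinate G (Lift.vector (lift (x i j))) (embed (from l)) ≡
                          (δ i l xor δ j l , δ i l xor δ j l)
  on-terminal i j l = trans (Lift.on (lift (x i j)) (from l)) (trans
    (cong (swapIf (twist (from l))) (cong₂ _,_
      (cong₂ _xor_ (δ-from i l) (δ-from j l)) (sum-from i j l)))
    (swapIf-diagonal (twist (from l)) (δ i l xor δ j l)))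

-- Nearly bipartite graphs have no certificate

module _ {G : Graph m} {v : Fin m} (C : K₄Certificate G v) where
  open K₄Certificate C

  -- The sum of all entries of `S` is evaluated by symmetry and by rows. For an edge with two
  -- colours, both orders give `z` at the end coloured `true` times `z′` at the other end;
  -- `exchange` supplies the symmetry for edges with one colour.
  no-nearly-2-colouring : (i j l : Fin 4) → i ≢ j → i ≢ l → j ≢ l → (f : Fin m → Bool) →
    (∀ a b → adj G a b ≡ true → f a ≡ f b →
      vector i j a ∧ vector i l b ≡ vector i j b ∧ vector i l a) → ⊥
  no-nearly-2-colouring i j l i≢j i≢l j≢l f exchange = contradiction false≡true λ ()
    where
    z = vector i j
    z′ = vector i l

    -- Symmetric by exchange, while its row sums (term) vanish except at terminal i.
    S : Fin m → Fin m → Bool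
    S a b = if f a then z a ∧ (adj G a b ∧ z′ b) else z′ a ∧ (adj G a b ∧ z b)

    term : Fin m → Bool
    term a = if f a then z a ∧ neighbourSum G z′ a else z′ a ∧ neighbourSum G z a

    sum-S : ∀ a → sum (S a) ≡ term a
    sum-S a with f a
    ... | true  = sym (*-distribˡ-sum (z a) λ b → adj G a b ∧ z′ b)
    ... | false = sym (*-distribˡ-sum (z′ a) λ b → adj G a b ∧ z b)

    S-sym : ∀ a b → S a b ≡ S b a
    S-sym a b = helper (f a) (f b) (adj G a b) (adj G b a) (z a) (z b) (z′ a) (z′ b)
                  (adj-sym G a b) (exchange a b)
      where
      helper : ∀ p q s t x y x′ y′ → s ≡ t → (s ≡ true → p ≡ q → x ∧ y′ ≡ y ∧ x′) →
        (if p then x ∧ (s ∧ y′) else x′ ∧ (s ∧ y)) ≡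
        (if q then y ∧ (t ∧ x′) else y′ ∧ (t ∧ x))
      helper p     q     false _ x y x′ y′ refl e = trans (zero-if p x x′) (sym (zero-if q y y′))
        where
        zero-if : ∀ p x x′ → (if p then x ∧ false else x′ ∧ false) ≡ false
        zero-if false x x′ = ∧-zeroʳ x′
        zero-if true  x x′ = ∧-zeroʳ x
      helper true  true  true  _ x y x′ y′ refl e = e refl refl
      helper true  false true  _ x y x′ y′ refl e = ∧-comm x y′
      helper false true  true  _ x y x′ y′ refl e = ∧-comm x′ y
      helper false false true  _ x y x′ y′ refl e =
        trans (∧-comm x′ y) (trans (sym (e refl refl)) (∧-comm x y′))

    S-irrefl : ∀ a → S a a ≡ false
    S-irrefl a rewrite adj-irrefl G a with f a
    ... | true  = ∧-zeroʳ (z a)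
    ... | false = ∧-zeroʳ (z′ a)

    term-terminal : ∀ h → term (terminal h) ≡ (δ i h xor δ j h) ∧ (δ i h xor δ l h)
    term-terminal h = trans
      -- At a terminal the two components of each vector agree, so both colours give the same
      -- product.
      (cong₂ (λ x y → if f (terminal h) then x else y)
        (cong₂ _∧_ (on i j h) (on-sum i l h))
        (trans (cong₂ _∧_ (on i l h) (on-sum i j h)) (∧-comm (δ i h xor δ l h) _)))
      (if-eta (f (terminal h)))

    term-off : ∀ a → (∀ h → terminal h ≢ a) → term a ≡ false
    -- Either branch of `term a` multiplies a first component by a second one. The common slot makes
    -- one of the factors zero, whichever vector it comes from.
    term-off a ∉terminal with slot a | off i j a ∉terminal | off i l a ∉terminal
    ... | true  | y≡0 | y′≡0 = trans
      (cong₂ (λ y y′ → if f a then z a ∧ y′ else z′ a ∧ y) y≡0 y′≡0)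
      (trans (cong₂ (λ x y → if f a then x else y) (∧-zeroʳ (z a)) (∧-zeroʳ (z′ a)))
        (if-eta (f a)))
    ... | false | x≡0 | x′≡0 = trans
      (cong₂ (λ x x′ → if f a then x ∧ neighbourSum G z′ a else x′ ∧ neighbourSum G z a) x≡0 x′≡0)
      (if-eta (f a))

    term-single : ∀ a → a ≢ terminal i → term a ≡ false
    term-single a a≢i with any? (λ h → terminal h ≟ a)
    ... | no  ∉terminal  = term-off a λ h e → ∉terminal (h , e)
    ... | yes (h , refl) = trans (term-terminal h) (helper (i ≟ h) (j ≟ h) (l ≟ h))
      where
      helper : (p : Dec (i ≡ h)) (q : Dec (j ≡ h)) (r : Dec (l ≡ h)) →
        (does p xor does q) ∧ (does p xor does r) ≡ false
      helper (yes refl) _          _          = contradiction refl a≢i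
      helper (no _)     (yes refl) (yes refl) = contradiction refl j≢l
      helper (no _)     (yes _)    (no _)     = refl
      helper (no _)     (no _)     _          = refl

    false≡true : false ≡ true
    false≡true = begin
      false
        ≡⟨ sum-alternating S S-sym S-irrefl ⟨
      sum (λ a → sum (S a))
        ≡⟨ sum-cong-≗ sum-S ⟩
      sum term
        ≡⟨ sum-single term (terminal i) term-single ⟩
      term (terminal i)
        ≡⟨ term-terminal i ⟩
      (δ i i xor δ j i) ∧ (δ i i xor δ l i)
        ≡⟨ cong₂ (λ p q → p ∧ q)
             (cong₂ _xor_ (dec-true (i ≟ i) refl) (dec-false (j ≟ i) (i≢j ∘ sym)))
             (cong₂ _xor_ (dec-true (i ≟ i) refl) (dec-false (l ≟ i) (i≢l ∘ sym))) ⟩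
      true ∎
      where open ≡-Reasoning

-- Twinned odd cycles and their reduction to K₄

-- With p, q the adjacencies of `x` to `u`, `v` and p′, q′ those of `y`, the three local
-- complementations contribute p p′, (q + p)(q′ + p′) and q q′, which add up to p q′ + q p′ over 𝔽₂.
pivot-adj : (G : Graph n) {u v : Fin n} → adj G u v ≡ true →
  (x y : Fin n) → x ≢ u → x ≢ v → y ≢ u → y ≢ v →
  adj (pivot G u v) x y ≡
  adj G x y xor (((adj G u x ∧ adj G v y) xor (adj G v x ∧ adj G u y)) ∧ distinct x y)
pivot-adj G {u} {v} uv x y x≢u x≢v y≢u y≢v = begin
  adj (pivot G u v) x y
    ≡⟨⟩
  ((adj G x y xor ((adj G u x ∧ adj G u y) ∧ distinct x y))
    xor ((adj G₁ v x ∧ adj G₁ v y) ∧ distinct x y))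
    xor ((adj G₂ u x ∧ adj G₂ u y) ∧ distinct x y)
    ≡⟨ cong₂ (λ s t → ((adj G x y xor ((adj G u x ∧ adj G u y) ∧ distinct x y))
                        xor (s ∧ distinct x y)) xor (t ∧ distinct x y))
         (cong₂ _∧_ (v₁ x x≢v) (v₁ y y≢v)) (cong₂ _∧_ (u₂ x x≢u x≢v) (u₂ y y≢u y≢v)) ⟩
  _ ≡⟨ bits (adj G x y) (adj G u x) (adj G u y) (adj G v x) (adj G v y) (distinct x y) ⟩
  adj G x y xor (((adj G u x ∧ adj G v y) xor (adj G v x ∧ adj G u y)) ∧ distinct x y) ∎
  where
  open ≡-Reasoning
  G₁ = G * u
  G₂ = G₁ * v
  vu₁ : adj G₁ v u ≡ true
  vu₁ = trans (adj-sym G₁ v u) (trans (*-adj-self G u v) uv)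
  v₁ : ∀ i → i ≢ v → adj G₁ v i ≡ adj G v i xor adj G u i
  v₁ = *-adj-neighbour G uv
  u₂ : ∀ i → i ≢ u → i ≢ v → adj G₂ u i ≡ adj G u i xor (adj G v i xor adj G u i)
  u₂ i i≢u i≢v = trans (*-adj-neighbour G₁ vu₁ i i≢u) (cong₂ _xor_ (*-adj-self G u i) (v₁ i i≢v))

  bits₁ : ∀ p p′ q q′ → ((p ∧ p′) xor ((q xor p) ∧ (q′ xor p′))) xor
    ((p xor (q xor p)) ∧ (p′ xor (q′ xor p′))) ≡ (p ∧ q′) xor (q ∧ p′)
  bits₁ false false false _     = refl
  bits₁ false false true  false = refl
  bits₁ false false true  true  = refl
  bits₁ false true  false false = refl
  bits₁ false true  false true  = refl
  bits₁ false true  true  false = refl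
  bits₁ false true  true  true  = refl
  bits₁ true  false false false = refl
  bits₁ true  false false true  = refl
  bits₁ true  false true  false = refl
  bits₁ true  false true  true  = refl
  bits₁ true  true  false false = refl
  bits₁ true  true  false true  = refl
  bits₁ true  true  true  false = refl
  bits₁ true  true  true  true  = refl

  collect : ∀ a r s t d → ((a xor (r ∧ d)) xor (s ∧ d)) xor (t ∧ d) ≡
    a xor (((r xor s) xor t) ∧ d)
  collect a r s t d = begin
    ((a xor (r ∧ d)) xor (s ∧ d)) xor (t ∧ d)
      ≡⟨ cong (_xor (t ∧ d)) (xor-assoc a (r ∧ d) (s ∧ d)) ⟩
    (a xor ((r ∧ d) xor (s ∧ d))) xor (t ∧ d)
      ≡⟨ xor-assoc a _ (t ∧ d) ⟩
    a xor (((r ∧ d) xor (s ∧ d)) xor (t ∧ d))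
      ≡⟨ cong (λ e → a xor (e xor (t ∧ d))) (∧-distribʳ-xor d r s) ⟨
    a xor (((r xor s) ∧ d) xor (t ∧ d))
      ≡⟨ cong (a xor_) (∧-distribʳ-xor d (r xor s) t) ⟨
    a xor (((r xor s) xor t) ∧ d) ∎

  bits : ∀ a p p′ q q′ d →
    ((a xor ((p ∧ p′) ∧ d)) xor (((q xor p) ∧ (q′ xor p′)) ∧ d)) xor
      (((p xor (q xor p)) ∧ (p′ xor (q′ xor p′))) ∧ d) ≡
    a xor (((p ∧ q′) xor (q ∧ p′)) ∧ d)
  bits a p p′ q q′ d = trans (collect a _ _ _ d)
    (cong (λ e → a xor (e ∧ d)) (bits₁ p p′ q q′))

double : ℕ → ℕ
double zero    = zero
double (suc k) = suc (suc (double k))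

pole : ℕ → ℕ
pole k = 2 + double k

size : ℕ → ℕ
size k = 2 + pole k

-- The minimum sends the last two vertices to the same place `pole k`; they are the twins.
position : ∀ k → Fin (size k) → ℕ
position k x = toℕ x ⊓ pole k

-- Equal positions count as near, which makes the twins adjacent; `distinct` in `twinnedCycle` then
-- removes the loops.
near : ℕ → ℕ → ℕ → Bool
near N a b = (∣ a - b ∣ ≤ᵇ 1) ∨ (((a ≡ᵇ 0) ∧ (b ≡ᵇ N)) ∨ ((a ≡ᵇ N) ∧ (b ≡ᵇ 0)))

near-sym : ∀ N a b → near N a b ≡ near N b a
near-sym N a b = cong₂ _∨_ (cong (_≤ᵇ 1) (∣-∣-comm a b))
  (trans (∨-comm ((a ≡ᵇ 0) ∧ (b ≡ᵇ N)) _)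
    (cong₂ _∨_ (∧-comm (a ≡ᵇ N) (b ≡ᵇ 0)) (∧-comm (a ≡ᵇ 0) (b ≡ᵇ N))))

-- The odd cycle 0, 1, …, pole k with its vertex pole k replaced by two
-- adjacent twins.
twinnedCycle : ∀ k → Graph (size k)
twinnedCycle k = record
  { adj        = λ x y → distinct x y ∧ near (pole k) (position k x) (position k y)
  ; adj-sym    = λ x y → cong₂ _∧_ (distinct-sym x y) (near-sym (pole k) (position k x) (position k y))
  ; adj-irrefl = λ x → cong (_∧ near (pole k) (position k x) (position k x)) (distinct-irrefl x)
  }

-- Among the remaining positions, 0 is near only the last one and 1 is near only 2. The pivot
-- correction thus joins the last position to 2, which closes the shorter cycle. As the last
-- position is at least 4, these two were not near before.
near-shift : ∀ m a b → let N = 2 + m in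
  near (2 + N) (2 + a) (2 + b) xor
    ((near (2 + N) 0 (2 + a) ∧ near (2 + N) 1 (2 + b)) xor
     (near (2 + N) 1 (2 + a) ∧ near (2 + N) 0 (2 + b))) ≡ near N a b
near-shift m zero          zero          = refl
near-shift m zero          (suc zero)    = refl
near-shift m zero          (suc (suc b)) = refl
near-shift m (suc zero)    zero          = refl
near-shift m (suc (suc a)) zero
  rewrite ∧-comm (a ≡ᵇ m) false | ∧-comm ((a ≡ᵇ m) ∨ false) true = bits (a ≡ᵇ m)
  where
  bits : ∀ p → (p ∨ false) xor false ≡ p ∧ true
  bits false = refl
  bits true  = refl
near-shift m (suc a)       (suc b)       = trans
  (cong (λ t → near (4 + m) (3 + a) (3 + b) xor (t xor false)) (∧-zeroʳ (near (4 + m) 0 (3 + a))))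
  (xor-identityʳ _)

-- The induction is on graphs `Q` that agree with the twinned cycle only in their adjacencies,
-- because the pivot and deletions yield a different `Graph` record. The base case is a triangle
-- with one vertex twinned.
twinnedCycle-hasK₄ : ∀ k {G : Graph m} {Q : Graph (size k)} → G ⇝ Q →
  (∀ x y → adj Q x y ≡ adj (twinnedCycle k) x y) → HasPivotMinor G K₄
twinnedCycle-hasK₄ zero {Q = Q} G⇝Q Q≗ = 4 , Q , G⇝Q , record
  { bijection = ↔-id (Fin 4)
  ; preserves = λ x y → trans (Q≗ x y) (K₄≗ x y)
  }
  where
  K₄≗ : ∀ x y → adj (twinnedCycle zero) x y ≡ adj K₄ x y
  K₄≗ = from-yes (all? λ x → all? λ y → adj (twinnedCycle zero) x y Bool.≟ adj K₄ x y)
twinnedCycle-hasK₄ (suc k) {Q = Q} G⇝Q Q≗ = twinnedCycle-hasK₄ k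
  -- After the first deletion the other end of the pivoted edge is numbered `zero`.
  (thenDelete (thenDelete (thenPivot G⇝Q zero (suc zero) (Q≗ zero (suc zero))) zero) zero)
  λ x y → begin
    adj (pivot Q zero (suc zero)) (suc (suc x)) (suc (suc y))
      ≡⟨ pivot-adj Q (Q≗ zero (suc zero)) (suc (suc x)) (suc (suc y)) (λ ()) (λ ()) (λ ()) (λ ()) ⟩
    _ ≡⟨ cong₂ (λ s t → s xor (t ∧ distinct x y)) (Q≗ (suc (suc x)) (suc (suc y)))
           (cong₂ _xor_
             (cong₂ _∧_ (Q≗ zero (suc (suc x))) (Q≗ (suc zero) (suc (suc y))))
             (cong₂ _∧_ (Q≗ (suc zero) (suc (suc x))) (Q≗ zero (suc (suc y))))) ⟩
    _ ≡⟨ collect (distinct x y) _ _ (near-shift (double k) (position k x) (position k y)) ⟩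
    adj (twinnedCycle k) x y ∎
  where
  open ≡-Reasoning
  collect : ∀ d s t {r} → s xor t ≡ r → (d ∧ s) xor (t ∧ d) ≡ d ∧ r
  collect false s t e = ∧-zeroʳ t
  collect true  s t e = trans (cong (s xor_) (∧-comm t true)) e

-- Colouring the odd cycle cut at one position

odd : ℕ → Bool
odd zero    = false
odd (suc a) = not (odd a)

odd-double : ∀ k → odd (double k) ≡ false
odd-double zero    = refl
odd-double (suc k) = trans (not-involutive _) (odd-double k)

-- Proper on the cycle 0, 1, …, N (N even) cut open at v.
colour : ℕ → ℕ → Bool
colour v a = odd a xor (v <ᵇ a)

<ᵇ-suc : ∀ v a → a ≢ v → (v <ᵇ suc a) ≡ (v <ᵇ a)
<ᵇ-suc zero    zero    a≢v = contradiction refl a≢v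
<ᵇ-suc zero    (suc a) a≢v = refl
<ᵇ-suc (suc v) zero    a≢v = refl
<ᵇ-suc (suc v) (suc a) a≢v = <ᵇ-suc v a (a≢v ∘ cong suc)

colour-suc : ∀ v a → a ≢ v → colour v (suc a) ≢ colour v a
colour-suc v a a≢v same = not-¬ refl (begin
  odd a xor (v <ᵇ a)            ≡⟨ same ⟨
  not (odd a) xor (v <ᵇ suc a)  ≡⟨ cong (not (odd a) xor_) (<ᵇ-suc v a a≢v) ⟩
  not (odd a) xor (v <ᵇ a)      ≡⟨ not-distribˡ-xor (odd a) (v <ᵇ a) ⟨
  not (odd a xor (v <ᵇ a))      ∎)
  where open ≡-Reasoning

-- Both ends have even parity, and the switch of colours after `v` separates them.
colour-poles : ∀ v N → odd N ≡ false → v ≢ 0 → v < N → colour v 0 ≢ colour v N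
colour-poles zero    N even v≢0 v<N same = v≢0 refl
colour-poles (suc v) N even v≢0 v<N same
  with () ← trans same (cong₂ _xor_ even (Equivalence.to T-≡ (<⇒<ᵇ v<N)))

∣-∣≤1 : ∀ a b → T (∣ a - b ∣ ≤ᵇ 1) → a ≡ b ⊎ b ≡ suc a ⊎ a ≡ suc b
∣-∣≤1 zero       zero       t = inj₁ refl
∣-∣≤1 zero       (suc zero) t = inj₂ (inj₁ refl)
∣-∣≤1 (suc zero) zero       t = inj₂ (inj₂ refl)
∣-∣≤1 (suc a)    (suc b)    t with ∣-∣≤1 a b t
... | inj₁ e        = inj₁ (cong suc e)
... | inj₂ (inj₁ e) = inj₂ (inj₁ (cong suc e))
... | inj₂ (inj₂ e) = inj₂ (inj₂ (cong suc e))

-- A step by one changes the colour unless it goes up from `v` (`colour-suc`), and the closing edge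
-- between 0 and `N` changes it by `colour-poles` when `v` is neither end. What remains are pairs
-- touching `v` and pairs of equal positions, the latter to cover the twins.
near-colour : ∀ N v a b → odd N ≡ false → v ≤ N →
  near N a b ≡ true → colour v a ≡ colour v b → (a ≡ v ⊎ b ≡ v) ⊎ a ≡ b
near-colour N v a b even v≤N ab same
  with Equivalence.to T-∨ (Equivalence.from T-≡ ab)
... | inj₁ t with ∣-∣≤1 a b t
...   | inj₁ a≡b         = inj₂ a≡b
...   | inj₂ (inj₁ refl) with a ℕ.≟ v
...     | yes a≡v = inj₁ (inj₁ a≡v)
...     | no  a≢v = contradiction (sym same) (colour-suc v a a≢v)
near-colour N v a b even v≤N ab same | inj₁ t | inj₂ (inj₂ refl) with b ℕ.≟ v
...     | yes b≡v = inj₁ (inj₂ b≡v)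
...     | no  b≢v = contradiction same (colour-suc v b b≢v)
near-colour N v a b even v≤N ab same | inj₂ t with Equivalence.to T-∨ t
... | inj₁ t₁ = helper (v ℕ.≟ 0) (v ℕ.≟ N) a≡0 b≡N
  where
  a≡0 = ≡ᵇ⇒≡ a 0 (proj₁ (Equivalence.to T-∧ t₁))
  b≡N = ≡ᵇ⇒≡ b N (proj₂ (Equivalence.to T-∧ t₁))
  helper : Dec (v ≡ 0) → Dec (v ≡ N) → a ≡ 0 → b ≡ N → (a ≡ v ⊎ b ≡ v) ⊎ a ≡ b
  helper (yes v≡0) _         a≡0  b≡N  = inj₁ (inj₁ (trans a≡0 (sym v≡0)))
  helper (no _)    (yes v≡N) a≡0  b≡N  = inj₁ (inj₂ (trans b≡N (sym v≡N)))
  helper (no v≢0)  (no v≢N)  refl refl = contradiction same (colour-poles v N even v≢0 (≤∧≢⇒< v≤N v≢N))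
... | inj₂ t₂ = helper (v ℕ.≟ 0) (v ℕ.≟ N) a≡N b≡0
  where
  a≡N = ≡ᵇ⇒≡ a N (proj₁ (Equivalence.to T-∧ t₂))
  b≡0 = ≡ᵇ⇒≡ b 0 (proj₂ (Equivalence.to (T-∧ {a ≡ᵇ N}) t₂))
  helper : Dec (v ≡ 0) → Dec (v ≡ N) → a ≡ N → b ≡ 0 → (a ≡ v ⊎ b ≡ v) ⊎ a ≡ b
  helper (yes v≡0) _         a≡N  b≡0  = inj₁ (inj₂ (trans b≡0 (sym v≡0)))
  helper (no _)    (yes v≡N) a≡N  b≡0  = inj₁ (inj₁ (trans a≡N (sym v≡N)))
  helper (no v≢0)  (no v≢N)  refl refl = contradiction (sym same) (colour-poles v N even v≢0 (≤∧≢⇒< v≤N v≢N))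

-- The twins

twin₀ twin₁ : ∀ k → Fin (size k)
twin₀ zero    = suc (suc zero)
twin₀ (suc k) = suc (suc (twin₀ k))
twin₁ zero    = suc (suc (suc zero))
twin₁ (suc k) = suc (suc (twin₁ k))

position-twin₀ : ∀ k → position k (twin₀ k) ≡ pole k
position-twin₀ zero    = refl
position-twin₀ (suc k) = cong (2 +_) (position-twin₀ k)

position-twin₁ : ∀ k → position k (twin₁ k) ≡ pole k
position-twin₁ zero    = refl
position-twin₁ (suc k) = cong (2 +_) (position-twin₁ k)

twin₀≢twin₁ : ∀ k → twin₀ k ≢ twin₁ k
twin₀≢twin₁ zero    ()
twin₀≢twin₁ (suc k) e = twin₀≢twin₁ k (suc-injective (suc-injective e))

at-pole : ∀ k x → position k x ≡ pole k → x ≡ twin₀ k ⊎ x ≡ twin₁ k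
at-pole zero    (suc (suc zero))       e = inj₁ refl
at-pole zero    (suc (suc (suc zero))) e = inj₂ refl
at-pole (suc k) (suc (suc x))          e =
  Sum.map (cong λ y → suc (suc y)) (cong λ y → suc (suc y))
    (at-pole k x (ℕ.suc-injective (ℕ.suc-injective e)))

same-position : ∀ k x y → position k x ≡ position k y → x ≡ y ⊎ position k x ≡ pole k
same-position k x y e with ⊓-sel (toℕ x) (pole k) | ⊓-sel (toℕ y) (pole k)
... | inj₂ x≡N | _        = inj₂ x≡N
... | inj₁ _   | inj₂ y≡N = inj₂ (trans e y≡N)
... | inj₁ x≡  | inj₁ y≡  = inj₁ (toℕ-injective (trans (sym x≡) (trans e y≡)))

twins-adj : ∀ k x → let G = twinnedCycle k in
  adj G (twin₀ k) x xor adj G (twin₁ k) x ≡ δ (twin₀ k) x xor δ (twin₁ k) x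
twins-adj k x rewrite position-twin₀ k | position-twin₁ k =
  helper (twin₀ k ≟ x) (twin₁ k ≟ x)
  where
  near-refl : ∀ N a → near N a a ≡ true
  near-refl N a rewrite ∣n-n∣≡0 a = refl
  near-pole : position k x ≡ pole k → near (pole k) (pole k) (position k x) ≡ true
  near-pole e rewrite e = near-refl (pole k) (pole k)
  helper : (p : Dec (twin₀ k ≡ x)) (q : Dec (twin₁ k ≡ x)) →
    let s = near (pole k) (pole k) (position k x) in
    (not (does p) ∧ s) xor (not (does q) ∧ s) ≡ does p xor does q
  helper (yes _)    (yes _)    = refl
  helper (yes refl) (no _)     = near-pole (position-twin₀ k)
  helper (no _)     (yes refl) = trans (xor-identityʳ _) (near-pole (position-twin₁ k))
  helper (no _)     (no _)     = xor-same (near (pole k) (pole k) (position k x))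

-- The adjacency rows of the twins differ exactly by the two unit vectors at the twins
-- (`twins-adj`), so the difference of the two neighbour sums is the difference of `z` at the twins.
twins-agree : ∀ k (z : Fin (size k) → Bool) → let G = twinnedCycle k in
  neighbourSum G z (twin₀ k) ≡ neighbourSum G z (twin₁ k) → z (twin₀ k) ≡ z (twin₁ k)
twins-agree k z e = xor-cancel (z c) (z d) (begin
  z c xor z d
    ≡⟨ cong₂ _xor_ (sum-∧-δ z c) (sum-∧-δ z d) ⟨
  sum (λ x → z x ∧ δ c x) xor sum (λ x → z x ∧ δ d x)
    ≡⟨ ∑-distrib-+ (λ x → z x ∧ δ c x) (λ x → z x ∧ δ d x) ⟨
  sum (λ x → (z x ∧ δ c x) xor (z x ∧ δ d x))
    ≡⟨ sum-cong-≗ (λ x → redistribute (z x) (adj G c x) (adj G d x) (δ c x) (δ d x) (twins-adj k x)) ⟩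
  sum (λ x → (adj G c x ∧ z x) xor (adj G d x ∧ z x))
    ≡⟨ ∑-distrib-+ (λ x → adj G c x ∧ z x) (λ x → adj G d x ∧ z x) ⟩
  neighbourSum G z c xor neighbourSum G z d
    ≡⟨ cong (_xor neighbourSum G z d) e ⟩
  neighbourSum G z d xor neighbourSum G z d
    ≡⟨ xor-same (neighbourSum G z d) ⟩
  false ∎)
  where
  open ≡-Reasoning
  G = twinnedCycle k
  c = twin₀ k
  d = twin₁ k
  xor-cancel : ∀ a b → a xor b ≡ false → a ≡ b
  xor-cancel false false _ = refl
  xor-cancel true  true  _ = refl
  redistribute : ∀ b p q r s → p xor q ≡ r xor s →
    (b ∧ r) xor (b ∧ s) ≡ (p ∧ b) xor (q ∧ b)
  redistribute b p q r s e = begin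
    (b ∧ r) xor (b ∧ s)  ≡⟨ ∧-distribˡ-xor b r s ⟨
    b ∧ (r xor s)        ≡⟨ cong (b ∧_) e ⟨
    b ∧ (p xor q)        ≡⟨ ∧-comm b (p xor q) ⟩
    (p xor q) ∧ b        ≡⟨ ∧-distribʳ-xor b p q ⟩
    (p ∧ b) xor (q ∧ b)  ∎

-- No certificate avoids a vertex of a twinned cycle

record Triple : Set where
  field
    i j l : Fin 4
    i≢j   : i ≢ j
    i≢l   : i ≢ l
    j≢l   : j ≢ l

-- Leaving `h` out of the triple makes both vectors of the colouring argument vanish at terminal
-- `h`.
others : (h : Fin 4) → Σ[ t ∈ Triple ] (Triple.i t ≢ h × Triple.j t ≢ h × Triple.l t ≢ h)
others zero =
  record { i = suc zero ; j = suc (suc zero) ; l = suc (suc (suc zero))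
         ; i≢j = λ () ; i≢l = λ () ; j≢l = λ () } , (λ ()) , (λ ()) , (λ ())
others (suc zero) =
  record { i = zero ; j = suc (suc zero) ; l = suc (suc (suc zero))
         ; i≢j = λ () ; i≢l = λ () ; j≢l = λ () } , (λ ()) , (λ ()) , (λ ())
others (suc (suc zero)) =
  record { i = zero ; j = suc zero ; l = suc (suc (suc zero))
         ; i≢j = λ () ; i≢l = λ () ; j≢l = λ () } , (λ ()) , (λ ()) , (λ ())
others (suc (suc (suc zero))) =
  record { i = zero ; j = suc zero ; l = suc (suc zero)
         ; i≢j = λ () ; i≢l = λ () ; j≢l = λ () } , (λ ()) , (λ ()) , (λ ())

module _ {k} {v : Fin (size k)} (C : K₄Certificate (twinnedCycle k) v) where
  open K₄Certificate C

  private
    c = twin₀ k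
    d = twin₁ k

  vanishes : ∀ {i j h} → i ≢ h → j ≢ h → vector i j (terminal h) ≡ false
  vanishes {i} {j} {h} i≢h j≢h = trans (on i j h)
    (cong₂ _xor_ (dec-false (i ≟ h) i≢h) (dec-false (j ≟ h) j≢h))

  terminal≢v : ∀ h → terminal h ≢ v
  terminal≢v h e with others h
  ... | t , i≢h , _ with () ← trans (sym (avoids h (Triple.i t)))
        (trans (cong (vector h (Triple.i t)) (sym e)) (trans (on h (Triple.i t) h)
          (cong₂ _xor_ (dec-true (h ≟ h) refl) (dec-false (Triple.i t ≟ h) i≢h))))

  module _ (t : Triple) where
    open Triple t

    Null : Fin (size k) → Set
    Null x = vector i j x ≡ false × vector i l x ≡ false

    TwinsExchange : Set
    TwinsExchange = vector i j c ∧ vector i l d ≡ vector i j d ∧ vector i l c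

    null-exchange : ∀ x y → Null x ⊎ Null y →
      vector i j x ∧ vector i l y ≡ vector i j y ∧ vector i l x
    null-exchange x y (inj₁ (p , q)) rewrite p | q = sym (∧-zeroʳ (vector i j y))
    null-exchange x y (inj₂ (p , q)) rewrite p | q = ∧-zeroʳ (vector i j x)

    -- Cut the cycle at position `p`. Monochromatic edges at `p` satisfy the exchange condition
    -- because both vectors vanish on one end; by `near-colour` the only other monochromatic edge
    -- can be the one between the twins.
    null-cut : ∀ p → p ≤ pole k → (∀ x → position k x ≡ p → Null x) → TwinsExchange → ⊥
    null-cut p p≤N null exchange =
      no-nearly-2-colouring C i j l i≢j i≢l j≢l (colour p ∘ position k) λ x y xy same →
        helper x y (near-colour (pole k) p (position k x) (position k y)
          (odd-double (suc k)) p≤N (∧-true xy) same)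
      where
      ∧-true : ∀ {a b} → a ∧ b ≡ true → b ≡ true
      ∧-true {true} e = e
      twins : ∀ x y → x ≡ c ⊎ x ≡ d → y ≡ c ⊎ y ≡ d →
        vector i j x ∧ vector i l y ≡ vector i j y ∧ vector i l x
      twins x y (inj₁ refl) (inj₁ refl) = refl
      twins x y (inj₁ refl) (inj₂ refl) = exchange
      twins x y (inj₂ refl) (inj₁ refl) = sym exchange
      twins x y (inj₂ refl) (inj₂ refl) = refl
      helper : ∀ x y → (position k x ≡ p ⊎ position k y ≡ p) ⊎ position k x ≡ position k y →
        vector i j x ∧ vector i l y ≡ vector i j y ∧ vector i l x
      helper x y (inj₁ e) = null-exchange x y (Sum.map (null x) (null y) e)
      helper x y (inj₂ e) with same-position k x y e
      ... | inj₁ refl = refl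
      ... | inj₂ x≡N  = twins x y (at-pole k x x≡N) (at-pole k y (trans (sym e) x≡N))

    -- If the slot of some twin selects the first component, both vectors vanish at that twin.
    -- Otherwise the neighbour sums of each vector are zero at both twins, and `twins-agree` equates
    -- its values there.
    exchange-off-terminals : (∀ h → terminal h ≢ c) → (∀ h → terminal h ≢ d) → TwinsExchange
    exchange-off-terminals c∉ d∉
      with slot c | off i j c c∉ | off i l c c∉ | slot d | off i j d d∉ | off i l d d∉
    ... | false | z | z′ | _     | _ | _  = null-exchange c d (inj₁ (z , z′))
    ... | true  | _ | _  | false | w | w′ = null-exchange c d (inj₂ (w , w′))
    ... | true  | z | z′ | true  | w | w′ = cong₂ _∧_
      (twins-agree k (vector i j) (trans z (sym w)))
      (sym (twins-agree k (vector i l) (trans z′ (sym w′))))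

  null-terminal : ∀ h → Null (proj₁ (others h)) (terminal h)
  null-terminal h with others h
  ... | _ , i≢h , j≢h , l≢h = vanishes i≢h j≢h , vanishes i≢h l≢h

  null-v : ∀ t → Null t v
  null-v t = avoids _ _ , avoids _ _

  some-exchange : Σ[ t ∈ Triple ] TwinsExchange t
  some-exchange with any? (λ h → terminal h ≟ c) | any? (λ h → terminal h ≟ d)
  -- A twin that is a terminal is made null by leaving its index out of the triple. If neither twin
  -- is a terminal, any triple works.
  ... | yes (h , e) | _           = proj₁ (others h) ,
    null-exchange (proj₁ (others h)) c d (inj₁ (subst (Null (proj₁ (others h))) e (null-terminal h)))
  ... | no _        | yes (h , e) = proj₁ (others h) ,
    null-exchange (proj₁ (others h)) c d (inj₂ (subst (Null (proj₁ (others h))) e (null-terminal h)))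
  ... | no c∉       | no d∉       = proj₁ (others zero) ,
    exchange-off-terminals (proj₁ (others zero)) (λ h e → c∉ (h , e)) (λ h e → d∉ (h , e))

  -- If `v` were a twin, it would already give the exchange at the twins, so the cut may be made at
  -- terminal zero with a triple omitting it. Should that terminal lie at the pole, it is the other
  -- twin, and both vertices at the pole are null.
  v-not-twin : position k v ≢ pole k
  v-not-twin v≡N = null-cut t (position k (terminal zero)) (m⊓n≤n _ _) null
    (null-exchange t c d (twin-null (at-pole k v v≡N)))
    where
    t = proj₁ (others zero)
    twin-null : v ≡ c ⊎ v ≡ d → Null t c ⊎ Null t d
    twin-null (inj₁ v≡c) = inj₁ (subst (Null t) v≡c (null-v t))
    twin-null (inj₂ v≡d) = inj₂ (subst (Null t) v≡d (null-v t))
    pigeonhole : ∀ {x y z} → x ≡ c ⊎ x ≡ d → y ≡ c ⊎ y ≡ d → z ≡ c ⊎ z ≡ d →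
      y ≢ z → x ≡ y ⊎ x ≡ z
    pigeonhole (inj₁ x≡c) (inj₁ y≡c) _          _   = inj₁ (trans x≡c (sym y≡c))
    pigeonhole (inj₂ x≡d) (inj₂ y≡d) _          _   = inj₁ (trans x≡d (sym y≡d))
    pigeonhole (inj₁ x≡c) (inj₂ _)   (inj₁ z≡c) _   = inj₂ (trans x≡c (sym z≡c))
    pigeonhole (inj₂ x≡d) (inj₁ _)   (inj₂ z≡d) _   = inj₂ (trans x≡d (sym z≡d))
    pigeonhole (inj₁ _)   (inj₂ y≡d) (inj₂ z≡d) y≢z = contradiction (trans y≡d (sym z≡d)) y≢z
    pigeonhole (inj₂ _)   (inj₁ y≡c) (inj₁ z≡c) y≢z = contradiction (trans y≡c (sym z≡c)) y≢z
    null : ∀ x → position k x ≡ position k (terminal zero) → Null t x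
    null x e with same-position k x (terminal zero) e
    ... | inj₁ x≡ = subst (Null t) (sym x≡) (null-terminal zero)
    ... | inj₂ x≡N with pigeonhole (at-pole k x x≡N)
                         (at-pole k (terminal zero) (trans (sym e) x≡N)) (at-pole k v v≡N)
                         (terminal≢v zero)
    ...   | inj₁ x≡ = subst (Null t) (sym x≡) (null-terminal zero)
    ...   | inj₂ x≡v = subst (Null t) (sym x≡v) (null-v t)

  no-certificate : ⊥
  -- Since `v` is not a twin, it is alone at its position, and it is null for every triple. The
  -- triple can therefore be chosen for the twins only.
  no-certificate = null-cut (proj₁ some-exchange) (position k v) (m⊓n≤n _ _) null
    (proj₂ some-exchange)
    where
    null : ∀ x → position k x ≡ position k v → Null (proj₁ some-exchange) x
    null x e with same-position k x v e
    ... | inj₁ x≡v = subst (Null (proj₁ some-exchange)) (sym x≡v) (null-v (proj₁ some-exchange))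
    ... | inj₂ x≡N  = contradiction (trans (sym e) x≡N) v-not-twin

-- Minimality and pairwise non-isomorphism

twinnedCycle-minimal : ∀ k S → S ⊂ ⊤ → ¬ HasPivotMinor (twinnedCycle k [ S ]) K₄
twinnedCycle-minimal k S (_ , v , _ , v∉S) (_ , P , G[S]⇝P , P≅K₄) = no-certificate
  (certificate (represents-⇝ (represents-induced (twinnedCycle k) v S v∉S) G[S]⇝P) P≅K₄)

double-injective : ∀ i j → double i ≡ double j → i ≡ j
double-injective zero    zero    e = refl
double-injective (suc i) (suc j) e =
  cong suc (double-injective i j (ℕ.suc-injective (ℕ.suc-injective e)))

proposition6p1 : Σ[ order ∈ (ℕ → ℕ) ] Σ[ F ∈ ((i : ℕ) → Graph (order i)) ]
    ((∀ i → 𝓕 K₄ (F i)) × (∀ i j → i ≢ j → ¬ (F i ≅ F j)))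
proposition6p1 = size , twinnedCycle ,
  (λ i → twinnedCycle-hasK₄ i start (λ _ _ → refl) , twinnedCycle-minimal i) ,
  -- Isomorphic graphs have equally many vertices, and `size i` is four plus twice `i`.
  (λ i j i≢j Fi≅Fj → i≢j (double-injective i j
    (ℕ.+-cancelˡ-≡ 4 (double i) (double j) (↔⇒≡ (_≅_.bijection Fi≅Fj)))))
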